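{- Let $m,n$ be positive integers. The map $\psi(\alpha)=(\alpha^E_m,\alpha^E_{m-1},\dots,\alpha^E_2,0)$ is an involution on $S_{m,n}$ (i.e. $\psi$ maps $S_{m,n}$ to itself and $\psi(\psi(\alpha))=\alpha$ for all $\alpha\in S_{m,n}$). More precisely, for every $\alpha\in S_{m,n}$ the tableau $C_{\psi(\alpha)}$ is obtained by rotating the tableau $C_\alpha$ by $180$ degrees.
   Context: Let $m,n$ be positive integers. $N(m,n)$ is the set of all integer vectors $\alpha=(\alpha_1,\dots,\alpha_m)$ with $0\le\alpha_i\le n$ for all $i$. The set $S_{m,n}$ consists of all $\alpha\in N(m,n)$ with $\alpha_m=0$, $\sum_{i=1}^m\alpha_i=k$ for some $0\le k\le\lfloor mn/2\rfloor$, and $\sum_{i=t}^{m-1}\alpha_i\le\sum_{i=t+1}^m(n-\alpha_i)$ for every $1\le t\le m-1$. For $\alpha\in S_{m,n}$ the tableau $C_\alpha$ is built as follows. Take an array of cells with $m$ rows (row $1$ at the top, row $m$ at the bottom) and $n$ columns. For each $i$, the first (leftmost) $\alpha_i$ cells of row $i$ are called fixed. Then, successively for $i=1,2,\dots,m-1$: starting at row $i+1$, read the cells that are neither fixed nor already declared forbidden, from right to left within each row and rows from top to bottom (rows $i+1,i+2,\dots,m$), and declare the first $\alpha_i$ of them forbidden. For $\alpha \in S_{m,n}$ there are always enough cells to do this. The cells that are neither fixed nor forbidden are called fillable. Fill the fillable cells successively with $1,2,3,\dots,\ell$ (where $\ell$ is their number), from left to right within each row and rows from bottom to top. Let $\alpha^E_i$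 be the number of forbidden cells in row $i$; then $\alpha^E_1=0$. Put $S(C_\alpha)=\alpha$ and $E(C_\alpha)=(n-\alpha^E_1,\dots,n-\alpha^E_m)$. The natural involution on $N(m,n)$ is $c^*=(n-c_m,n-c_{m-1},\dots,n-c_1)$, and $\psi$ is the map induced by it: $\psi(S(C_\alpha))=(E(C_\alpha))^*$, which is $\psi(\alpha)=(\alpha^E_m,\alpha^E_{m-1},\dots,\alpha^E_2,0)$. Rotation by $180$ degrees sends the cell in row $i$, column $j$ to the cell in row $m+1-i$, column $n+1-j$. In rotating a tableau, the roles of fixed and forbidden cells are exchanged (images of forbidden cells of $C_\alpha$ are the fixed cells of the new tableau and images of fixed cells are its forbidden cells), fillable cells go to fillable cells, and the numbering of the fillable cells is reversed (the image of the cell with entry $r$ has entry $\ell+1-r$). -}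

module Defs where

open import Data.Bool using (if_then_else_)
open import Data.Fin as Fin using (Fin; zero; suc; toℕ; opposite)
open import Data.List as List using (List; []; _∷_; allFin; cartesianProduct; filter; foldl; length; reverse; take)
open import Data.Nat using (ℕ; zero; suc; _*_; _∸_; _≤_; _<_; _<?_; ⌊_/2⌋)
open import Data.Nat.ListAction using (sum)
open import Data.Product using (∃; _×_; _,_)
open import Data.Vec as Vec using (Vec; []; _∷ʳ_; lookup)
open import Data.Vec.Functional using (Vector; updateAt)
open import Function using (const)
open import Relation.Binary.PropositionalEquality using (_≡_; refl)
open import Relation.Nullary using (Dec; yes; no; does)

-- Rows and columns are numbered from 0: the 1-based row i is the element of
-- Fin m with toℕ equal to i - 1, and similarly for columns.

rowsBelow : ∀ {m} → Fin m → List (Fin m)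
rowsBelow {m} t = filter (λ i → t Fin.<? i) (allFin m)

rowsExceptLast : ∀ m → List (Fin m)
rowsExceptLast m = filter (λ i → suc (toℕ i) <? m) (allFin m)

∑ : ∀ {m} → List (Fin m) → (Fin m → ℕ) → ℕ
∑ is f = sum (List.map f is)

-- The truncated subtraction n ∸ αᵢ is exact because of `bounded`.
record S (m n : ℕ) (α : Vec ℕ m) : Set where
  field
    bounded  : ∀ i → lookup α i ≤ n
    last≡0   : ∀ i → suc (toℕ i) ≡ m → lookup α i ≡ 0
    size     : Vec.sum α ≤ ⌊ m * n /2⌋
    capacity : ∀ t → suc (toℕ t) < m →
               ∑ (filter (λ i → t Fin.≤? i) (rowsExceptLast m)) (λ i → lookup α i)
                 ≤ ∑ (rowsBelow t) (λ i → n ∸ lookup α i)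

-- `blank` is a cell that is neither fixed nor forbidden and carries no number
-- (yet); a finished tableau has no blank cells.
data Entry : Set where
  blank fixed forbidden : Entry
  number : ℕ → Entry

IsNumber : Entry → Set
IsNumber x = ∃ λ r → x ≡ number r

blank? : (x : Entry) → Dec (x ≡ blank)
blank? blank      = yes refl
blank? fixed      = no λ ()
blank? forbidden  = no λ ()
blank? (number _) = no λ ()

forbidden? : (x : Entry) → Dec (x ≡ forbidden)
forbidden? blank      = no λ ()
forbidden? fixed      = no λ ()
forbidden? forbidden  = yes refl
forbidden? (number _) = no λ ()

number? : (x : Entry) → Dec (IsNumber x)
number? blank      = no λ ()
number? fixed      = no λ ()
number? forbidden  = no λ ()
number? (number r) = yes (r , refl)

rotateEntry : ℕ → Entry → Entry
rotateEntry ℓ blank      = blank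
rotateEntry ℓ fixed      = forbidden
rotateEntry ℓ forbidden  = fixed
rotateEntry ℓ (number r) = number (suc ℓ ∸ r)

Tableau : ℕ → ℕ → Set
Tableau m n = Vector (Vector Entry n) m

Cell : ℕ → ℕ → Set
Cell m n = Fin m × Fin n

module _ {m n : ℕ} where

  _[_]≔_ : Tableau m n → Cell m n → Entry → Tableau m n
  T [ i , j ]≔ x = updateAt T i (λ row → updateAt row j (const x))

  blankCells : Tableau m n → List (Cell m n) → List (Cell m n)
  blankCells T = filter (λ (i , j) → blank? (T i j))

  -- Rows below row i from top to bottom, each row from right to left.
  cellsBelow : Fin m → List (Cell m n)
  cellsBelow i = cartesianProduct (rowsBelow i) (reverse (allFin n))

  -- Rows from bottom to top, each row from left to right.
  fillingOrder : List (Cell m n)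
  fillingOrder = cartesianProduct (reverse (allFin m)) (allFin n)

  fixCells : Vec ℕ m → Tableau m n
  fixCells α i j = if does (toℕ j <? lookup α i) then fixed else blank

  forbidStep : Vec ℕ m → Tableau m n → Fin m → Tableau m n
  forbidStep α T i =
    foldl (λ T′ c → T′ [ c ]≔ forbidden) T (take (lookup α i) (blankCells T (cellsBelow i)))

  forbidCells : Vec ℕ m → Tableau m n → Tableau m n
  forbidCells α T = foldl (forbidStep α) T (rowsExceptLast m)

  fillFrom : ℕ → List (Cell m n) → Tableau m n → Tableau m n
  fillFrom r []       T = T
  fillFrom r (c ∷ cs) T = fillFrom (suc r) cs (T [ c ]≔ number r)

  fill : Tableau m n → Tableau m n
  fill T = fillFrom 1 (blankCells T fillingOrder) T

  -- The number ℓ of fillable cells of a finished tableau.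
  numberCount : Tableau m n → ℕ
  numberCount T = length (filter (λ (i , j) → number? (T i j)) fillingOrder)

  rotate : Tableau m n → Tableau m n
  rotate T i j = rotateEntry (numberCount T) (T (opposite i) (opposite j))

C : ∀ {m} n → Vec ℕ m → Tableau m n
C n α = fill (forbidCells α (fixCells α))

αᴱ : ∀ {m} n → Vec ℕ m → Fin m → ℕ
αᴱ n α i = length (filter (λ j → forbidden? (C n α i j)) (allFin n))

-- (αᴱₘ , … , αᴱ₂ , 0); the case m = 0 is a dummy.
ψ : ∀ {m} → ℕ → Vec ℕ m → Vec ℕ m
ψ {zero}  n α = []
ψ {suc m} n α = Vec.tabulate (λ (i : Fin m) → αᴱ n α (suc (opposite i))) ∷ʳ 0

{-# OPTIONS --safe #-}
module Submission where

-- Read the rows from top to bottom as a queue: in row i first min (n - αᵢ , qᵢ)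
-- waiting customers depart and then αᵢ new ones arrive.  Since forbidden cells
-- are chosen greedily, the departures of row i are exactly its forbidden cells,
-- and α ∈ S says that the queue is empty at the end.  The identity
-- αᵢ = min (n - αᵢᴱ , qᵢ₊₁) shows that the queue run backwards in time is again
-- such a queue, with arrivals and departures exchanged.  Hence the process
-- started from ψ(α) forbids α reversed, which is rotation by 180 degrees, and
-- the numbering is reversed because rotation reverses the filling order.

open import Data.Bool using (true; false; if_then_else_)
open import Data.Fin as Fin using (Fin; zero; suc; toℕ; opposite)
open import Data.Fin.Properties using (toℕ<n; opposite-prop; opposite-involutive)
open import Data.List as List
  using (List; []; _∷_; _++_; allFin; cartesianProduct; filter; foldl; length; map; reverse; take)
open import Data.List.Membership.Propositional using (_∈_; _∉_)
open import Data.List.Membership.Propositional.Properties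
  using (∈-∃++; ∈-allFin; ∈-cartesianProduct⁺; ∈-map⁺; ∈-filter⁻)
open import Data.List.Properties
  using ( ++-assoc; ++-identityʳ; cartesianProductWith-distribʳ-++; filter-++; filter-accept; filter-all
        ; filter-none; filter-reject; filter-≐; foldl-++; length-++; length-map; map-++; map-id
        ; map-tabulate; map-∘; reverse-++; reverse-involutive; reverse-map; take-[]; take-map; unfold-reverse)
open import Data.List.Relation.Binary.Permutation.Propositional.Properties using (↭-reverse; filter-↭; ↭-length)
open import Data.List.Relation.Unary.All as All using ()
open import Data.List.Relation.Unary.AllPairs using (_∷_)
open import Data.List.Relation.Unary.Any using (here; there)
open import Data.List.Relation.Unary.Unique.Propositional using (Unique)
import Data.List.Relation.Unary.Unique.Propositional.Properties as Unique
open import Data.Nat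
open import Data.Nat.ListAction using (sum)
open import Data.Nat.Properties
open import Data.Product using (_×_; _,_; proj₁; proj₂)
open import Data.Sum using (inj₁; inj₂)
open import Data.Unit using (⊤; tt)
open import Data.Vec as Vec using (Vec; []; _∷_; _∷ʳ_; lookup)
open import Data.Vec.Functional using (Vector; updateAt)
open import Data.Vec.Functional.Properties using (updateAt-updates; updateAt-minimal)
open import Data.Vec.Properties
  using (reverse-∷; tabulate-cong; tabulate∘lookup) renaming (reverse-involutive to Vec-reverse-involutive)
open import Function using (_∘_; const; id)
open import Level using (0ℓ)
open import Relation.Binary.PropositionalEquality
open import Relation.Nullary using (does; yes; no; ¬_; contradiction)
open import Relation.Nullary.Decidable using (dec-true; dec-false)
open import Relation.Unary using (Pred; Decidable)
open import Defs

-- Each step of the forbidding process rewrites a whole tableau, but one number describes the state.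
-- When row i has its turn, the forbidden cells below it are an initial segment of the unfixed cells
-- in reading order, and its length is what the departures of row i leave of the queue. Removing the
-- top row therefore turns the process into the recursion of `departures`. The rows that remain see
-- a nonempty queue, so the lemmas about the queue start from an arbitrary `q`. Each capacity
-- inequality of `S` says that the arrivals from row t on fit into the free cells below t. That
-- these inequalities together are equivalent to an empty final queue comes from the truncated
-- subtraction in the queue recursion. The bound on the sum passes to `ψ` because everyone who
-- arrives also departs.

-- The queue and its time reversal

departures : ∀ {m} → ℕ → ℕ → Vec ℕ m → Vec ℕ m
departures n q []      = []
departures n q (a ∷ α) = ((n ∸ a) ⊓ q) ∷ departures n (q ∸ (n ∸ a) + a) α

finalQueue : ∀ {m} → ℕ → ℕ → Vec ℕ m → ℕ
finalQueue n q []      = q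
finalQueue n q (a ∷ α) = finalQueue n (q ∸ (n ∸ a) + a) α

departures-∷ʳ : ∀ {m} n q (α : Vec ℕ m) a →
  departures n q (α ∷ʳ a) ≡ departures n q α ∷ʳ ((n ∸ a) ⊓ finalQueue n q α)
departures-∷ʳ n q []      a = refl
departures-∷ʳ n q (b ∷ α) a = cong (_ ∷_) (departures-∷ʳ n _ α a)

finalQueue-∷ʳ : ∀ {m} n q (α : Vec ℕ m) a →
  finalQueue n q (α ∷ʳ a) ≡ finalQueue n q α ∸ (n ∸ a) + a
finalQueue-∷ʳ n q []      a = refl
finalQueue-∷ʳ n q (b ∷ α) a = finalQueue-∷ʳ n _ α a

module _ {n a : ℕ} (q : ℕ) (a≤n : a ≤ n) where

  private
    b = n ∸ a

  -- If `b ≤ q`, the row is filled, `n ∸ b` is `a`, and at least `a` customers wait afterwards. If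
  -- `q ≤ b`, the queue has emptied, so exactly the `a` newcomers wait, and `n ∸ q` is at least `a`.
  arrival-reversed : (n ∸ (b ⊓ q)) ⊓ (q ∸ b + a) ≡ a
  arrival-reversed with ≤-total b q
  ... | inj₁ b≤q rewrite m≤n⇒m⊓n≡m b≤q | m∸[m∸n]≡n a≤n = m≤n⇒m⊓n≡m (m≤n+m a (q ∸ b))
  ... | inj₂ q≤b rewrite m≥n⇒m⊓n≡n q≤b | m≤n⇒m∸n≡0 q≤b =
    m≥n⇒m⊓n≡n (subst (_≤ n ∸ q) (m∸[m∸n]≡n a≤n) (∸-monoʳ-≤ n q≤b))

  queue-reversed : q ∸ b + a ∸ (n ∸ (b ⊓ q)) + (b ⊓ q) ≡ q
  queue-reversed with ≤-total b q
  ... | inj₁ b≤q rewrite m≤n⇒m⊓n≡m b≤q | m∸[m∸n]≡n a≤n | m+n∸n≡m (q ∸ b) a = m∸n+n≡m b≤q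
  ... | inj₂ q≤b rewrite m≥n⇒m⊓n≡n q≤b | m≤n⇒m∸n≡0 q≤b =
    cong (_+ q) (m≤n⇒m∸n≡0 (subst (_≤ n ∸ q) (m∸[m∸n]≡n a≤n) (∸-monoʳ-≤ n q≤b)))

Bounded : ∀ {m} → ℕ → Vec ℕ m → Set
Bounded n α = ∀ i → lookup α i ≤ n

-- The backward run starts from the forward `finalQueue`, whatever that is. Reversal puts the first
-- row last, so the induction hypothesis covers the backward run up to that row and leaves a single
-- step.
reversal : ∀ {m} n q (α : Vec ℕ m) → Bounded n α →
  departures n (finalQueue n q α) (Vec.reverse (departures n q α)) ≡ Vec.reverse α
  × finalQueue n (finalQueue n q α) (Vec.reverse (departures n q α)) ≡ q
reversal n q []      α≤n = refl , refl
reversal n q (a ∷ α) α≤n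
  with deps , end ← reversal n (q ∸ (n ∸ a) + a) α (α≤n ∘ suc)
  rewrite reverse-∷ ((n ∸ a) ⊓ q) (departures n (q ∸ (n ∸ a) + a) α)
        | reverse-∷ a α
        | departures-∷ʳ n (finalQueue n (q ∸ (n ∸ a) + a) α)
            (Vec.reverse (departures n (q ∸ (n ∸ a) + a) α)) ((n ∸ a) ⊓ q)
        | finalQueue-∷ʳ n (finalQueue n (q ∸ (n ∸ a) + a) α)
            (Vec.reverse (departures n (q ∸ (n ∸ a) + a) α)) ((n ∸ a) ⊓ q)
        | deps | end
  = cong (Vec.reverse α ∷ʳ_) (arrival-reversed q (α≤n zero)) , queue-reversed q (α≤n zero)

-- Nobody is lost in the queue. With both ends empty, this carries the size bound of `S` over to the
-- reversed departures.
conservation : ∀ {m} n q (α : Vec ℕ m) →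
  Vec.sum (departures n q α) + finalQueue n q α ≡ q + Vec.sum α
conservation n q []      = sym (+-identityʳ q)
conservation n q (a ∷ α) = begin
  (b ⊓ q) + Vec.sum (departures n q′ α) + finalQueue n q′ α   ≡⟨ +-assoc (b ⊓ q) _ _ ⟩
  (b ⊓ q) + (Vec.sum (departures n q′ α) + finalQueue n q′ α) ≡⟨ cong ((b ⊓ q) +_) (conservation n q′ α) ⟩
  (b ⊓ q) + (q ∸ b + a + Vec.sum α)                           ≡⟨ cong ((b ⊓ q) +_) (+-assoc (q ∸ b) a _) ⟩
  (b ⊓ q) + (q ∸ b + (a + Vec.sum α))                         ≡⟨ +-assoc (b ⊓ q) _ _ ⟨
  (b ⊓ q) + (q ∸ b) + (a + Vec.sum α)                         ≡⟨ cong (_+ (a + Vec.sum α)) (m⊓n+n∸m≡n b q) ⟩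
  q + (a + Vec.sum α)                                         ∎
  where
  open ≡-Reasoning
  b = n ∸ a
  q′ = q ∸ b + a

-- Sums and entries of reversed vectors

sum-∷ʳ : ∀ {m} (α : Vec ℕ m) a → Vec.sum (α ∷ʳ a) ≡ Vec.sum α + a
sum-∷ʳ []      a = +-identityʳ a
sum-∷ʳ (b ∷ α) a = trans (cong (b +_) (sum-∷ʳ α a)) (sym (+-assoc b _ a))

sum-reverse : ∀ {m} (α : Vec ℕ m) → Vec.sum (Vec.reverse α) ≡ Vec.sum α
sum-reverse []      = refl
sum-reverse (a ∷ α) rewrite reverse-∷ a α =
  trans (sum-∷ʳ (Vec.reverse α) a) (trans (cong (_+ a) (sum-reverse α)) (+-comm _ a))

lookup-∷ʳ-fromℕ : ∀ {A : Set} {m} (α : Vec A m) a → lookup (α ∷ʳ a) (Fin.fromℕ m) ≡ a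
lookup-∷ʳ-fromℕ []      a = refl
lookup-∷ʳ-fromℕ (b ∷ α) a = lookup-∷ʳ-fromℕ α a

lookup-∷ʳ-inject₁ : ∀ {A : Set} {m} (α : Vec A m) a i → lookup (α ∷ʳ a) (Fin.inject₁ i) ≡ lookup α i
lookup-∷ʳ-inject₁ (b ∷ α) a zero    = refl
lookup-∷ʳ-inject₁ (b ∷ α) a (suc i) = lookup-∷ʳ-inject₁ α a i

lookup-reverse-opposite : ∀ {A : Set} {m} (α : Vec A m) i →
  lookup (Vec.reverse α) (opposite i) ≡ lookup α i
lookup-reverse-opposite (a ∷ α) i rewrite reverse-∷ a α with i
... | zero  = lookup-∷ʳ-fromℕ (Vec.reverse α) a
... | suc i = trans (lookup-∷ʳ-inject₁ (Vec.reverse α) a (opposite i)) (lookup-reverse-opposite α i)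

-- Capacity inequalities and the empty final queue

free : ∀ {m} → ℕ → Vec ℕ m → ℕ
free n []      = 0
free n (a ∷ α) = n ∸ a + free n α

-- Unlike in S, the left-hand sums include the last entry, so the condition for
-- the last row says αₘ ≤ 0.
Capacity : ∀ {m} → ℕ → Vec ℕ m → Set
Capacity n []      = ⊤
Capacity n (a ∷ α) = a + Vec.sum α ≤ free n α × Capacity n α

-- `m ∸ n` is the larger of m - n and 0, so the bound amounts to two inequalities, one for each
-- value.
m∸n+o≤p : ∀ m n {o p} → m + o ≤ n + p → o ≤ p → m ∸ n + o ≤ p
m∸n+o≤p m       zero    h o≤p = h
m∸n+o≤p zero    (suc n) h o≤p = o≤p
m∸n+o≤p (suc m) (suc n) h o≤p = m∸n+o≤p m n (s≤s⁻¹ h) o≤p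

m+o≤n+p : ∀ m n {o p} → m ∸ n + o ≤ p → m + o ≤ n + p
m+o≤n+p m n {o} {p} h = begin
  m + o             ≤⟨ +-monoˡ-≤ o (m≤n+m∸n m n) ⟩
  n + (m ∸ n) + o   ≡⟨ +-assoc n _ o ⟩
  n + (m ∸ n + o)   ≤⟨ +-monoʳ-≤ n h ⟩
  n + p             ∎
  where open ≤-Reasoning

-- Whoever waits or is still to arrive must find a free cell. Discarding the customers held over
-- past the first row from the inequality for the later rows leaves the capacity inequality of the
-- first row.
finalQueue≡0⇒capacity : ∀ {m} n q (α : Vec ℕ m) → finalQueue n q α ≡ 0 →
  q + Vec.sum α ≤ free n α × Capacity n α
finalQueue≡0⇒capacity n q []      refl = z≤n , tt
finalQueue≡0⇒capacity n q (a ∷ α) end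
  with h , cap ← finalQueue≡0⇒capacity n (q ∸ (n ∸ a) + a) α end
  with h′ ← subst (_≤ free n α) (+-assoc (q ∸ (n ∸ a)) a (Vec.sum α)) h
  = m+o≤n+p q (n ∸ a) h′ , m+n≤o⇒n≤o (q ∸ (n ∸ a)) h′ , cap

-- A row that is filled lowers both sides of the inequality for `q` equally. A row that empties the
-- queue leaves only its own arrivals waiting, and its capacity inequality takes over.
capacity⇒finalQueue≡0 : ∀ {m} n q (α : Vec ℕ m) →
  q + Vec.sum α ≤ free n α → Capacity n α → finalQueue n q α ≡ 0
capacity⇒finalQueue≡0 n q []      h cap = n≤0⇒n≡0 (m+n≤o⇒m≤o q h)
capacity⇒finalQueue≡0 n q (a ∷ α) h (h₀ , cap) =
  capacity⇒finalQueue≡0 n (q ∸ (n ∸ a) + a) α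
    (subst (_≤ free n α) (sym (+-assoc (q ∸ (n ∸ a)) a (Vec.sum α))) (m∸n+o≤p q (n ∸ a) h h₀)) cap

-- The inequalities of `S` in recursive form

filter-map : ∀ {A B : Set} {P : Pred B 0ℓ} (P? : Decidable P) (f : A → B) xs →
  filter P? (map f xs) ≡ map f (filter (P? ∘ f) xs)
filter-map P? f []       = refl
filter-map P? f (x ∷ xs) with does (P? (f x))
... | true  = cong (f x ∷_) (filter-map P? f xs)
... | false = filter-map P? f xs

allFin-suc : ∀ m → allFin (suc m) ≡ zero ∷ map suc (allFin m)
allFin-suc m = cong (zero ∷_) (sym (map-tabulate id suc))

rowsBelow-zero : ∀ {m} → rowsBelow {suc m} zero ≡ map suc (allFin m)
rowsBelow-zero {m} =
  trans (cong (filter (zero {m} Fin.<?_)) (allFin-suc m))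
 (trans (filter-map (zero {m} Fin.<?_) suc (allFin m))
        (cong (map suc) (filter-all (λ i → zero {m} Fin.<? suc i) (All.universal (λ _ → z<s) (allFin m)))))

rowsBelow-suc : ∀ {m} (t : Fin m) → rowsBelow (suc t) ≡ map suc (rowsBelow t)
rowsBelow-suc {m} t =
  trans (cong (filter (suc t Fin.<?_)) (allFin-suc m))
 (trans (filter-map (suc t Fin.<?_) suc (allFin m))
        (cong (map suc) (filter-≐ (λ i → suc t Fin.<? suc i) (t Fin.<?_) (s≤s⁻¹ , s≤s) (allFin m))))

rowsExceptLast-suc : ∀ m → rowsExceptLast (suc (suc m)) ≡ zero ∷ map suc (rowsExceptLast (suc m))
rowsExceptLast-suc m =
  trans (cong (filter P?) (allFin-suc (suc m)))
 (trans (filter-accept P? {x = zero} {xs = map suc (allFin (suc m))} (s<s z<s))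
        (cong (zero ∷_) (trans (filter-map P? suc (allFin (suc m)))
           (cong (map suc) (filter-≐ (P? ∘ suc) (λ i → suc (toℕ i) <? suc m) (s≤s⁻¹ , s≤s) (allFin (suc m)))))))
  where P? = λ (i : Fin (suc (suc m))) → suc (toℕ i) <? suc (suc m)

∑-map : ∀ {m k} (σ : Fin k → Fin m) is (f : Fin m → ℕ) → ∑ (map σ is) f ≡ ∑ is (f ∘ σ)
∑-map σ is f = cong sum (sym (map-∘ is))

∑-allFin-free : ∀ {m} n (α : Vec ℕ m) → ∑ (allFin m) (λ i → n ∸ lookup α i) ≡ free n α
∑-allFin-free         n []      = refl
∑-allFin-free {suc m} n (a ∷ α) =
  trans (cong (λ is → ∑ is (λ i → n ∸ lookup (a ∷ α) i)) (allFin-suc m))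
        (cong (n ∸ a +_) (trans (∑-map suc (allFin m) _) (∑-allFin-free n α)))

LastZero : ∀ {m} → Vec ℕ m → Set
LastZero {m} α = ∀ i → suc (toℕ i) ≡ m → lookup α i ≡ 0

∑-rowsExceptLast : ∀ {m} (α : Vec ℕ m) → LastZero α → ∑ (rowsExceptLast m) (lookup α) ≡ Vec.sum α
∑-rowsExceptLast []          last = refl
∑-rowsExceptLast (a ∷ [])    last = sym (trans (+-identityʳ a) (last zero refl))
∑-rowsExceptLast {suc (suc m)} (a ∷ α@(_ ∷ _)) last =
  trans (cong (λ is → ∑ is (lookup (a ∷ α))) (rowsExceptLast-suc m))
        (cong (a +_) (trans (∑-map suc (rowsExceptLast (suc m)) _)
                     (∑-rowsExceptLast α (λ i → last (suc i) ∘ cong suc))))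

CapacityAt : ∀ {m} → ℕ → Vec ℕ m → Fin m → Set
CapacityAt {m} n α t =
  ∑ (filter (λ i → t Fin.≤? i) (rowsExceptLast m)) (λ i → lookup α i)
    ≤ ∑ (rowsBelow t) (λ i → n ∸ lookup α i)

demand-zero : ∀ {m} (α : Vec ℕ (suc m)) → LastZero α →
  ∑ (filter (λ i → zero {m} Fin.≤? i) (rowsExceptLast (suc m))) (lookup α) ≡ Vec.sum α
demand-zero {m} α last =
  trans (cong (λ is → ∑ is (lookup α)) (filter-all (zero {m} Fin.≤?_) (All.universal (λ _ → z≤n) (rowsExceptLast (suc m)))))
        (∑-rowsExceptLast α last)

demand-suc : ∀ {m} a (α : Vec ℕ (suc m)) (t : Fin (suc m)) →
  ∑ (filter (λ i → suc t Fin.≤? i) (rowsExceptLast (suc (suc m)))) (lookup (a ∷ α))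
    ≡ ∑ (filter (λ i → t Fin.≤? i) (rowsExceptLast (suc m))) (lookup α)
demand-suc {m} a α t =
  trans (cong (λ is → ∑ is (lookup (a ∷ α)))
   (trans (cong (filter (λ i → suc t Fin.≤? i)) (rowsExceptLast-suc m))
          (trans (filter-map (suc t Fin.≤?_) suc (rowsExceptLast (suc m)))
                 (cong (map suc) (filter-≐ (λ i → suc t Fin.≤? suc i) (t Fin.≤?_) (s≤s⁻¹ , s≤s) (rowsExceptLast (suc m)))))))
        (∑-map suc (filter (t Fin.≤?_) (rowsExceptLast (suc m))) _)

supply-zero : ∀ {m} n a (α : Vec ℕ m) →
  ∑ (rowsBelow zero) (λ i → n ∸ lookup (a ∷ α) i) ≡ free n α
supply-zero {m} n a α =
  trans (cong (λ is → ∑ is (λ i → n ∸ lookup (a ∷ α) i)) (rowsBelow-zero {m}))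
 (trans (∑-map suc (allFin m) _) (∑-allFin-free n α))

supply-suc : ∀ {m} n a (α : Vec ℕ m) t →
  ∑ (rowsBelow (suc t)) (λ i → n ∸ lookup (a ∷ α) i) ≡ ∑ (rowsBelow t) (λ i → n ∸ lookup α i)
supply-suc n a α t =
  trans (cong (λ is → ∑ is (λ i → n ∸ lookup (a ∷ α) i)) (rowsBelow-suc t))
        (∑-map suc (rowsBelow t) _)

capacityAt⇒capacity : ∀ {m} n (α : Vec ℕ m) → LastZero α →
  (∀ t → suc (toℕ t) < m → CapacityAt n α t) → Capacity n α
capacityAt⇒capacity n [] last cap = tt
-- The inequalities of `S` stop before the last row; there the vanishing last entry supplies the
-- missing one.
capacityAt⇒capacity n (a ∷ []) last cap =
  ≤-reflexive (trans (+-identityʳ a) (last zero refl)) , tt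
capacityAt⇒capacity n (a ∷ α@(_ ∷ _)) last cap =
  subst₂ _≤_ (demand-zero (a ∷ α) last) (supply-zero n a α) (cap zero (s<s z<s)) ,
  capacityAt⇒capacity n α (λ i → last (suc i) ∘ cong suc) λ t t<m →
    subst₂ _≤_ (demand-suc a α t) (supply-suc n a α t) (cap (suc t) (s<s t<m))

capacity⇒lastZero : ∀ {m} n (α : Vec ℕ m) → Capacity n α → LastZero α
capacity⇒lastZero n (a ∷ [])        (h , _)   zero    eq = n≤0⇒n≡0 (m+n≤o⇒m≤o a h)
capacity⇒lastZero n (a ∷ (_ ∷ _))   (_ , cap) zero    ()
capacity⇒lastZero n (a ∷ α)         (_ , cap) (suc i) eq = capacity⇒lastZero n α cap i (suc-injective eq)

capacity⇒capacityAt : ∀ {m} n (α : Vec ℕ m) → Capacity n α → ∀ t → CapacityAt n α t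
capacity⇒capacityAt n (a ∷ α) cap@(h , _) zero =
  subst₂ _≤_ (sym (demand-zero (a ∷ α) (capacity⇒lastZero n (a ∷ α) cap))) (sym (supply-zero n a α)) h
capacity⇒capacityAt n (a ∷ α@(_ ∷ _)) (_ , cap) (suc t) =
  subst₂ _≤_ (sym (demand-suc a α t)) (sym (supply-suc n a α t)) (capacity⇒capacityAt n α cap t)

S⇒finalQueue≡0 : ∀ {m} n (α : Vec ℕ m) → S m n α → finalQueue n 0 α ≡ 0
S⇒finalQueue≡0 n []      s = refl
S⇒finalQueue≡0 n (a ∷ α) s with cap ← capacityAt⇒capacity n (a ∷ α) (S.last≡0 s) (S.capacity s) =
  capacity⇒finalQueue≡0 n 0 (a ∷ α) (m≤n⇒m≤o+n (n ∸ a) (proj₁ cap)) cap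

finalQueue≡0⇒S : ∀ {m} n (α : Vec ℕ m) →
  Bounded n α → Vec.sum α ≤ ⌊ m * n /2⌋ → finalQueue n 0 α ≡ 0 → S m n α
finalQueue≡0⇒S n α bounded size end with cap ← proj₂ (finalQueue≡0⇒capacity n 0 α end) = record
  { bounded  = bounded
  ; last≡0   = capacity⇒lastZero n α cap
  ; size     = size
  ; capacity = λ t _ → capacity⇒capacityAt n α cap t
  }

-- Forbidding cells within one row

take-++ : ∀ {A : Set} p (xs ys : List A) → take p (xs ++ ys) ≡ take p xs ++ take (p ∸ length xs) ys
take-++ zero    []       ys = refl
take-++ zero    (x ∷ xs) ys = refl
take-++ (suc p) []       ys = refl
take-++ (suc p) (x ∷ xs) ys = cong (x ∷_) (take-++ p xs ys)

-- The argument q may exceed the n ∸ a cells that are not fixed: shape a q is the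
-- row as left behind by a queue of length q.
shape : ∀ {n} → ℕ → ℕ → Vector Entry n
shape {n} a q j = if does (toℕ j <? a) then fixed else if does (n ∸ toℕ j ≤? q) then forbidden else blank

shape-fixed : ∀ {n} {a q} (j : Fin n) → toℕ j < a → shape a q j ≡ fixed
shape-fixed {a = a} j j<a rewrite dec-true (toℕ j <? a) j<a = refl

shape-forbidden : ∀ {n} {a q} (j : Fin n) → a ≤ toℕ j → n ∸ toℕ j ≤ q → shape a q j ≡ forbidden
shape-forbidden {n} {a} {q} j a≤j h
  rewrite dec-false (toℕ j <? a) (≤⇒≯ a≤j) | dec-true (n ∸ toℕ j ≤? q) h = refl

shape-blank : ∀ {n} {a q} (j : Fin n) → a ≤ toℕ j → q < n ∸ toℕ j → shape a q j ≡ blank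
shape-blank {n} {a} {q} j a≤j h
  rewrite dec-false (toℕ j <? a) (≤⇒≯ a≤j) | dec-false (n ∸ toℕ j ≤? q) (<⇒≱ h) = refl

forbidRow : ∀ {n} → Vector Entry n → List (Fin n) → Vector Entry n
forbidRow = foldl λ r j → updateAt r j (const forbidden)

blanks : ∀ {n} → Vector Entry n → List (Fin n) → List (Fin n)
blanks r = filter (λ j → blank? (r j))

columns : ∀ n → List (Fin n)
columns n = reverse (allFin n)

columns-suc : ∀ n → columns (suc n) ≡ map suc (columns n) ++ zero ∷ []
columns-suc n = begin
  reverse (allFin (suc n))            ≡⟨ cong reverse (allFin-suc n) ⟩
  reverse (zero ∷ map suc (allFin n)) ≡⟨ unfold-reverse zero (map suc (allFin n)) ⟩
  reverse (map suc (allFin n)) ++ zero ∷ [] ≡⟨ cong (_++ zero ∷ []) (sym (reverse-map suc (allFin n))) ⟩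
  map suc (columns n) ++ zero ∷ [] ∎
  where open ≡-Reasoning

-- An equality of functions, available without extensionality because updateAt
-- computes on suc; this lets it be used under foldl.
forbidRow-map-suc : ∀ {n} (r : Vector Entry (suc n)) js →
  (λ j → forbidRow r (map suc js) (suc j)) ≡ forbidRow (r ∘ suc) js
forbidRow-map-suc r []       = refl
forbidRow-map-suc r (j ∷ js) = forbidRow-map-suc (updateAt r (suc j) (const forbidden)) js

forbidRow-map-suc-zero : ∀ {n} (r : Vector Entry (suc n)) js → forbidRow r (map suc js) zero ≡ r zero
forbidRow-map-suc-zero r []       = refl
forbidRow-map-suc-zero r (j ∷ js) = forbidRow-map-suc-zero (updateAt r (suc j) (const forbidden)) js

module _ {n} (r : Vector Entry (suc n)) where

  private
    B = blanks (r ∘ suc) (columns n)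

  blanks-columns-suc : blanks r (columns (suc n)) ≡ map suc B ++ blanks r (zero ∷ [])
  blanks-columns-suc = begin
    blanks r (columns (suc n))                           ≡⟨ cong (blanks r) (columns-suc n) ⟩
    blanks r (map suc (columns n) ++ zero ∷ [])          ≡⟨ filter-++ _ (map suc (columns n)) _ ⟩
    blanks r (map suc (columns n)) ++ blanks r (zero ∷ []) ≡⟨ cong (_++ blanks r (zero ∷ [])) (filter-map _ suc (columns n)) ⟩
    map suc B ++ blanks r (zero ∷ [])                     ∎
    where open ≡-Reasoning

  -- Reading from right to left reaches column zero last, so it receives only what the blank cells
  -- to its right leave of `p`.
  forbidRow-columns-suc : ∀ p → forbidRow r (take p (blanks r (columns (suc n)))) ≡
    forbidRow (forbidRow r (map suc (take p B))) (take (p ∸ length B) (blanks r (zero ∷ [])))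
  forbidRow-columns-suc p = begin
    forbidRow r (take p (blanks r (columns (suc n)))) ≡⟨ cong (forbidRow r ∘ take p) blanks-columns-suc ⟩
    forbidRow r (take p (map suc B ++ rest)) ≡⟨ cong (forbidRow r) (take-++ p (map suc B) rest) ⟩
    forbidRow r (take p (map suc B) ++ take (p ∸ length (map suc B)) rest)
      ≡⟨ cong₂ (λ xs k → forbidRow r (xs ++ take (p ∸ k) rest)) (take-map p B) (length-map suc B) ⟩
    forbidRow r (map suc (take p B) ++ take (p ∸ length B) rest)
      ≡⟨ foldl-++ _ r (map suc (take p B)) _ ⟩
    forbidRow (forbidRow r (map suc (take p B))) (take (p ∸ length B) rest) ∎
    where
    open ≡-Reasoning
    rest = blanks r (zero ∷ [])

length-blanks-nonblank : ∀ {n} (r : Vector Entry (suc n)) → r zero ≢ blank →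
  length (blanks r (columns (suc n))) ≡ length (blanks (r ∘ suc) (columns n))
length-blanks-nonblank {n} r r₀≢blank
  rewrite blanks-columns-suc r
        | filter-reject (λ j → blank? (r j)) {xs = []} r₀≢blank
        | ++-identityʳ (map Fin.suc (blanks (r ∘ suc) (columns n)))
  = length-map suc (blanks (r ∘ suc) (columns n))

length-blanks-blank : ∀ {n} (r : Vector Entry (suc n)) → r zero ≡ blank →
  length (blanks r (columns (suc n))) ≡ suc (length (blanks (r ∘ suc) (columns n)))
length-blanks-blank {n} r r₀≡blank
  rewrite blanks-columns-suc r
        | filter-accept (λ j → blank? (r j)) {xs = []} r₀≡blank
        | length-++ (map Fin.suc (blanks (r ∘ suc) (columns n))) {zero ∷ []}
        | length-map Fin.suc (blanks (r ∘ suc) (columns n))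
  = +-comm _ 1

-- Columns are removed from the left. This does not change the distance `n ∸ toℕ j` to the right
-- end, so the tail of a shape is again a shape by computation.
length-blanks-shape : ∀ n a q (r : Vector Entry n) → r ≗ shape a q →
  length (blanks r (columns n)) ≡ n ∸ a ∸ q
length-blanks-shape zero    zero    zero    r r≗ = refl
length-blanks-shape zero    zero    (suc q) r r≗ = refl
length-blanks-shape zero    (suc a) q       r r≗ = sym (0∸n≡0 q)
length-blanks-shape (suc n) (suc a) q r r≗ =
  trans (length-blanks-nonblank r λ r₀≡blank → contradiction (trans (sym (r≗ zero)) r₀≡blank) λ ())
        (length-blanks-shape n a q (r ∘ suc) (r≗ ∘ suc))
length-blanks-shape (suc n) zero q r r≗ with <-≤-connex n q
... | inj₁ n<q =
  trans (length-blanks-nonblank r λ r₀≡blank →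
          contradiction (trans (sym (trans (r≗ zero) (shape-forbidden (zero {n}) z≤n n<q))) r₀≡blank) λ ())
 (trans (length-blanks-shape n 0 q (r ∘ suc) (r≗ ∘ suc))
        (trans (m≤n⇒m∸n≡0 (<⇒≤ n<q)) (sym (m≤n⇒m∸n≡0 n<q))))
... | inj₂ q≤n =
  trans (length-blanks-blank r (trans (r≗ zero) (shape-blank (zero {n}) z≤n (s≤s q≤n))))
 (trans (cong suc (length-blanks-shape n 0 q (r ∘ suc) (r≗ ∘ suc)))
        (sym (+-∸-assoc 1 q≤n)))

module _ {n} (r : Vector Entry (suc n)) (p : ℕ) where

  private
    B      = blanks (r ∘ suc) (columns n)
    marked = forbidRow r (take p (blanks r (columns (suc n))))

  forbidRow-columns-at-suc : ∀ j → marked (suc j) ≡ forbidRow (r ∘ suc) (take p B) j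
  forbidRow-columns-at-suc j rewrite forbidRow-columns-suc r p =
    trans step (cong-app (forbidRow-map-suc r (take p B)) j)
    where
    step : forbidRow (forbidRow r (map suc (take p B)))
             (take (p ∸ length B) (blanks r (zero ∷ []))) (suc j)
           ≡ forbidRow r (map suc (take p B)) (suc j)
    -- The remaining list holds at most column zero and cannot touch `suc j`; the cases only let
    -- `take` compute.
    step with p ∸ length B | does (blank? (r zero))
    ... | zero   | _     = refl
    ... | suc k  | false = refl
    ... | 1      | true  = refl
    ... | 2+ k   | true  = refl

  forbidRow-columns-at-zero-nonblank : r zero ≢ blank → marked zero ≡ r zero
  forbidRow-columns-at-zero-nonblank r₀≢blank
    rewrite forbidRow-columns-suc r p
          | filter-reject (λ j → blank? (r j)) {xs = []} r₀≢blank
          | take-[] {A = Fin (suc n)} (p ∸ length B) =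
    forbidRow-map-suc-zero r (take p B)

  forbidRow-columns-at-zero-exhausted : p ≤ length B → marked zero ≡ r zero
  forbidRow-columns-at-zero-exhausted p≤B
    rewrite forbidRow-columns-suc r p | m≤n⇒m∸n≡0 p≤B =
    forbidRow-map-suc-zero r (take p B)

  forbidRow-columns-at-zero-forbidden : r zero ≡ blank → length B < p → marked zero ≡ forbidden
  forbidRow-columns-at-zero-forbidden r₀≡blank B<p
    rewrite forbidRow-columns-suc r p
          | filter-accept (λ j → blank? (r j)) {xs = []} r₀≡blank
    with p ∸ length B in eq
  ... | zero  = contradiction B<p (≤⇒≯ (m∸n≡0⇒m≤n eq))
  ... | suc k rewrite take-[] {A = Fin (suc n)} k = refl

-- The forbidden cells form a block at the right end, and the blank cells next to it are read first,
-- so the block grows by `p`. An unfixed column zero is forbidden already, reached now or not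
-- reached, depending on how `n` compares with `q` and `q + p`.
forbidRow-shape : ∀ n a q p (r : Vector Entry n) → r ≗ shape a q →
  forbidRow r (take p (blanks r (columns n))) ≗ shape a (q + p)
forbidRow-shape (suc n) (suc a) q p r r≗ (suc j) =
  trans (forbidRow-columns-at-suc r p j) (forbidRow-shape n a q p (r ∘ suc) (r≗ ∘ suc) j)
forbidRow-shape (suc n) zero    q p r r≗ (suc j) =
  trans (forbidRow-columns-at-suc r p j) (forbidRow-shape n 0 q p (r ∘ suc) (r≗ ∘ suc) j)
forbidRow-shape (suc n) (suc a) q p r r≗ zero =
  trans (forbidRow-columns-at-zero-nonblank r p λ r₀≡blank → contradiction (trans (sym (r≗ zero)) r₀≡blank) λ ())
        (r≗ zero)
forbidRow-shape (suc n) zero    q p r r≗ zero with <-≤-connex n q | <-≤-connex n (q + p)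
... | inj₁ n<q | _ =
  trans (forbidRow-columns-at-zero-nonblank r p
          λ r₀≡blank → contradiction (trans (sym r₀≡forbidden) r₀≡blank) λ ())
 (trans r₀≡forbidden (sym (shape-forbidden (zero {n}) z≤n (m≤n⇒m≤n+o p n<q))))
  where
  r₀≡forbidden : r zero ≡ forbidden
  r₀≡forbidden = trans (r≗ zero) (shape-forbidden (zero {n}) z≤n n<q)
... | inj₂ q≤n | inj₁ n<q+p =
  trans (forbidRow-columns-at-zero-forbidden r p (trans (r≗ zero) (shape-blank (zero {n}) z≤n (s≤s q≤n)))
          (subst (_< p) (sym (length-blanks-shape n 0 q (r ∘ suc) (r≗ ∘ suc))) n∸q<p))
        (sym (shape-forbidden (zero {n}) z≤n n<q+p))
  where
  n∸q<p : n ∸ q < p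
  n∸q<p = +-cancelˡ-< q (n ∸ q) p (subst (_< q + p) (sym (m+[n∸m]≡n q≤n)) n<q+p)
... | inj₂ q≤n | inj₂ q+p≤n =
  trans (forbidRow-columns-at-zero-exhausted r p
          (subst (p ≤_) (sym (length-blanks-shape n 0 q (r ∘ suc) (r≗ ∘ suc)))
            (m+n≤o⇒m≤o∸n p (subst (_≤ n) (+-comm q p) q+p≤n))))
 (trans (r≗ zero) (trans (shape-blank (zero {n}) z≤n (s≤s q≤n)) (sym (shape-blank (zero {n}) z≤n (s≤s q+p≤n)))))

length-forbidden-shape : ∀ n a q →
  length (filter (λ j → forbidden? (shape {n} a q j)) (allFin n)) ≡ (n ∸ a) ⊓ q
length-forbidden-shape zero    a       q rewrite 0∸n≡0 a = refl
length-forbidden-shape (suc n) (suc a) q = begin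
  length (filter P? (allFin (suc n)))      ≡⟨ cong (length ∘ filter P?) (allFin-suc n) ⟩
  length (filter P? (map suc (allFin n)))  ≡⟨ cong length (filter-map P? suc (allFin n)) ⟩
  length (map Fin.suc (filter (P? ∘ suc) (allFin n))) ≡⟨ length-map Fin.suc (filter (P? ∘ suc) (allFin n)) ⟩
  length (filter (P? ∘ suc) (allFin n))    ≡⟨ length-forbidden-shape n a q ⟩
  (n ∸ a) ⊓ q                              ∎
  where
  open ≡-Reasoning
  P? = λ j → forbidden? (shape {suc n} (suc a) q j)
length-forbidden-shape (suc n) zero    q with <-≤-connex n q
... | inj₁ n<q = begin
  length (filter P? (allFin (suc n)))      ≡⟨ cong (length ∘ filter P?) (allFin-suc n) ⟩
  length (filter P? (zero ∷ map suc (allFin n)))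
    ≡⟨ cong length (filter-accept P? {x = zero} {xs = map suc (allFin n)} (shape-forbidden {suc n} zero z≤n n<q)) ⟩
  suc (length (filter P? (map suc (allFin n))))  ≡⟨ cong (suc ∘ length) (filter-map P? suc (allFin n)) ⟩
  suc (length (map Fin.suc (filter (P? ∘ suc) (allFin n)))) ≡⟨ cong suc (length-map Fin.suc (filter (P? ∘ suc) (allFin n))) ⟩
  suc (length (filter (P? ∘ suc) (allFin n)))    ≡⟨ cong suc (length-forbidden-shape n 0 q) ⟩
  suc (n ⊓ q)     ≡⟨ cong suc (m≤n⇒m⊓n≡m (<⇒≤ n<q)) ⟩
  suc n           ≡⟨ m≤n⇒m⊓n≡m n<q ⟨
  suc n ⊓ q       ∎
  where
  open ≡-Reasoning
  P? = λ j → forbidden? (shape {suc n} zero q j)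
... | inj₂ q≤n = begin
  length (filter P? (allFin (suc n)))      ≡⟨ cong (length ∘ filter P?) (allFin-suc n) ⟩
  length (filter P? (zero ∷ map suc (allFin n)))
    ≡⟨ cong length (filter-reject P? {x = zero} {xs = map suc (allFin n)}
         λ p → contradiction (trans (sym (shape-blank {suc n} zero z≤n (s≤s q≤n))) p) λ ()) ⟩
  length (filter P? (map suc (allFin n)))  ≡⟨ cong length (filter-map P? suc (allFin n)) ⟩
  length (map Fin.suc (filter (P? ∘ suc) (allFin n))) ≡⟨ length-map Fin.suc (filter (P? ∘ suc) (allFin n)) ⟩
  length (filter (P? ∘ suc) (allFin n))    ≡⟨ length-forbidden-shape n 0 q ⟩
  n ⊓ q     ≡⟨ m≥n⇒m⊓n≡n q≤n ⟩
  q         ≡⟨ m≥n⇒m⊓n≡n (m≤n⇒m≤1+n q≤n) ⟨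
  suc n ⊓ q       ∎
  where
  open ≡-Reasoning
  P? = λ j → forbidden? (shape {suc n} zero q j)

-- A block longer than the `n ∸ a` free cells would continue under the fixed ones, which take
-- priority. Hence the queue length and the number of departures describe the same row.
shape-⊓ : ∀ {n} a q → shape {n} a ((n ∸ a) ⊓ q) ≗ shape a q
shape-⊓ {n} a q j with <-≤-connex (toℕ j) a
... | inj₁ j<a = trans (shape-fixed j j<a) (sym (shape-fixed j j<a))
... | inj₂ a≤j with ≤-<-connex (n ∸ toℕ j) q
...   | inj₁ le = trans (shape-forbidden j a≤j (⊓-glb (∸-monoʳ-≤ n a≤j) le)) (sym (shape-forbidden j a≤j le))
...   | inj₂ gt = trans (shape-blank j a≤j (≤-<-trans (m⊓n≤n (n ∸ a) q) gt)) (sym (shape-blank j a≤j gt))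

-- `opposite` exchanges the distances to the two ends of the row. `shape` lets fixed cells win over
-- forbidden ones and rotation reverses that priority, so the two blocks must be disjoint, which is
-- `e ≤ n ∸ a`. Any `ℓ` will do, since a shape has no numbers.
shape-rotated : ∀ {n} ℓ a e → e ≤ n ∸ a → (j : Fin n) →
  shape e a (opposite j) ≡ rotateEntry ℓ (shape a e j)
shape-rotated {n} ℓ a e e≤n∸a j with <-≤-connex (toℕ j) a
... | inj₁ j<a rewrite shape-fixed {q = e} j j<a =
  shape-forbidden (opposite j)
    (subst (e ≤_) (sym (opposite-prop j)) (≤-trans e≤n∸a (∸-monoʳ-≤ n j<a)))
    (subst (_≤ a) (sym n∸opposite) j<a)
  where
  n∸opposite : n ∸ toℕ (opposite j) ≡ suc (toℕ j)
  n∸opposite = trans (cong (n ∸_) (opposite-prop j)) (m∸[m∸n]≡n (toℕ<n j))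
... | inj₂ a≤j with ≤-<-connex (n ∸ toℕ j) e
...   | inj₁ le rewrite shape-forbidden j a≤j le =
  shape-fixed (opposite j) (subst (_≤ e) (trans (+-∸-assoc 1 (toℕ<n j)) (cong suc (sym (opposite-prop j)))) le)
...   | inj₂ gt rewrite shape-blank j a≤j gt =
  shape-blank (opposite j)
    (s≤s⁻¹ (subst (e <_) (trans (+-∸-assoc 1 (toℕ<n j)) (cong suc (sym (opposite-prop j)))) gt))
    (subst (a <_) (sym (trans (cong (n ∸_) (opposite-prop j)) (m∸[m∸n]≡n (toℕ<n j)))) (s≤s a≤j))

-- Removing the top row of a tableau

cartesianProduct-map : ∀ {A B A′ B′ : Set} (f : A → A′) (g : B → B′) xs ys →
  cartesianProduct (map f xs) (map g ys) ≡ map (λ (x , y) → f x , g y) (cartesianProduct xs ys)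
cartesianProduct-map f g []       ys = refl
cartesianProduct-map f g (x ∷ xs) ys = begin
  map (f x ,_) (map g ys) ++ cartesianProduct (map f xs) (map g ys)
    ≡⟨ cong₂ _++_ (trans (sym (map-∘ ys)) (map-∘ ys)) (cartesianProduct-map f g xs ys) ⟩
  map _ (map (x ,_) ys) ++ map _ (cartesianProduct xs ys)
    ≡⟨ map-++ _ (map (x ,_) ys) _ ⟨
  map _ (map (x ,_) ys ++ cartesianProduct xs ys) ∎
  where open ≡-Reasoning

module _ {m n : ℕ} where

  down : Cell m n → Cell (suc m) n
  down (i , j) = suc i , j

  forbid : Tableau m n → List (Cell m n) → Tableau m n
  forbid = foldl λ T c → T [ c ]≔ forbidden

  allCells : List (Cell m n)
  allCells = cartesianProduct (allFin m) (columns n)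

  -- The last row is included, unlike in `forbidCells`, so that the recursion over rows has no
  -- special final case. No cell lies below that row, so its step changes nothing.
  forbidAll : Vec ℕ m → Tableau m n → Tableau m n
  forbidAll α T = foldl (forbidStep α) T (allFin m)

module _ {m n : ℕ} where

  forbid-down : (T : Tableau (suc m) n) (cs : List (Cell m n)) →
    (λ i → forbid T (map down cs) (suc i)) ≡ forbid (T ∘ suc) cs
  forbid-down T []       = refl
  forbid-down T (c ∷ cs) = forbid-down (T [ down c ]≔ forbidden) cs

  forbid-down-zero : (T : Tableau (suc m) n) (cs : List (Cell m n)) → forbid T (map down cs) zero ≡ T zero
  forbid-down-zero T []       = refl
  forbid-down-zero T (c ∷ cs) = forbid-down-zero (T [ down c ]≔ forbidden) cs

  forbid-top : (T : Tableau (suc m) n) (js : List (Fin n)) →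
    forbid T (map (zero ,_) js) zero ≡ forbidRow (T zero) js
  forbid-top T []       = refl
  forbid-top T (j ∷ js) = forbid-top (T [ zero , j ]≔ forbidden) js

  forbid-top-suc : (T : Tableau (suc m) n) (js : List (Fin n)) →
    forbid T (map (zero ,_) js) ∘ suc ≡ T ∘ suc
  forbid-top-suc T []       = refl
  forbid-top-suc T (j ∷ js) = forbid-top-suc (T [ zero , j ]≔ forbidden) js

  cartesianProduct-down : (is : List (Fin m)) →
    cartesianProduct (map suc is) (columns n) ≡ map (down {m} {n}) (cartesianProduct is (columns n))
  cartesianProduct-down is = trans (cong (cartesianProduct (map suc is)) (sym (map-id (columns n))))
    (cartesianProduct-map suc id is (columns n))

  allCells-suc : allCells {suc m} {n} ≡ map (zero ,_) (columns n) ++ map down allCells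
  allCells-suc = trans (cong (λ is → cartesianProduct is (columns n)) (allFin-suc m))
    (cong (map (zero ,_) (columns n) ++_) (cartesianProduct-down (allFin m)))

  blankCells-down : (T : Tableau (suc m) n) (cs : List (Cell m n)) →
    blankCells T (map down cs) ≡ map down (blankCells (T ∘ suc) cs)
  blankCells-down T = filter-map (λ (i , j) → blank? (T i j)) down

  forbid-blanks-down : ∀ p (T : Tableau (suc m) n) (cs : List (Cell m n)) →
    (λ i → forbid T (take p (blankCells T (map down cs))) (suc i))
      ≡ forbid (T ∘ suc) (take p (blankCells (T ∘ suc) cs))
  forbid-blanks-down p T cs = trans
    (cong (λ ds i → forbid T ds (suc i))
      (trans (cong (take p) (blankCells-down T cs)) (take-map p (blankCells (T ∘ suc) cs))))
    (forbid-down T (take p (blankCells (T ∘ suc) cs)))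

  forbid-blanks-down-zero : ∀ p (T : Tableau (suc m) n) (cs : List (Cell m n)) →
    forbid T (take p (blankCells T (map down cs))) zero ≡ T zero
  forbid-blanks-down-zero p T cs = trans
    (cong (λ ds → forbid T ds zero)
      (trans (cong (take p) (blankCells-down T cs)) (take-map p (blankCells (T ∘ suc) cs))))
    (forbid-down-zero T (take p (blankCells (T ∘ suc) cs)))

  module _ (p : ℕ) (T : Tableau (suc m) n) where

    private
      R = blanks (T zero) (columns n)
      B = blankCells (T ∘ suc) allCells

    -- The top row is read first, and only the excess of `p` over its blank cells passes to the rows
    -- below: this is the overflow of the queue.
    take-blankCells-allCells : take p (blankCells T allCells)
      ≡ map (zero ,_) (take p R) ++ map down (take (p ∸ length R) B)
    take-blankCells-allCells = begin
      take p (blankCells T allCells)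
        ≡⟨ cong (take p ∘ blankCells T) allCells-suc ⟩
      take p (blankCells T (map (zero ,_) (columns n) ++ map down allCells))
        ≡⟨ cong (take p) (filter-++ _ (map (zero ,_) (columns n)) _) ⟩
      take p (blankCells T (map (zero ,_) (columns n)) ++ blankCells T (map down allCells))
        ≡⟨ cong₂ (λ xs ys → take p (xs ++ ys)) (filter-map _ (zero ,_) (columns n)) (blankCells-down T allCells) ⟩
      take p (map (zero ,_) R ++ map down B)
        ≡⟨ take-++ p (map (zero ,_) R) (map down B) ⟩
      take p (map (zero ,_) R) ++ take (p ∸ length (map {B = Cell (suc m) n} (zero ,_) R)) (map down B)
        ≡⟨ cong₂ _++_ (take-map p R)
            (trans (cong (λ k → take (p ∸ k) (map down B)) (length-map (zero ,_) R)) (take-map (p ∸ length R) B)) ⟩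
      map (zero ,_) (take p R) ++ map down (take (p ∸ length R) B) ∎
      where open ≡-Reasoning

    private
      T₁ = forbid T (map (zero ,_) (take p R))

      forbid-split : forbid T (take p (blankCells T allCells)) ≡ forbid T₁ (map down (take (p ∸ length R) B))
      forbid-split = trans (cong (forbid T) take-blankCells-allCells) (foldl-++ _ T (map (zero ,_) (take p R)) _)

    forbid-allCells-zero : forbid T (take p (blankCells T allCells)) zero ≡ forbidRow (T zero) (take p R)
    forbid-allCells-zero = trans (cong-app forbid-split zero)
      (trans (forbid-down-zero T₁ (take (p ∸ length R) B)) (forbid-top T (take p R)))

    forbid-allCells-suc : forbid T (take p (blankCells T allCells)) ∘ suc
      ≡ forbid (T ∘ suc) (take (p ∸ length R) B)
    forbid-allCells-suc = trans (cong (_∘ suc) forbid-split)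
      (trans (forbid-down T₁ (take (p ∸ length R) B))
             (cong (λ T → forbid T (take (p ∸ length R) B)) (forbid-top-suc T (take p R))))

  -- The step of a row below the top reads and changes only cells further down, so it commutes with
  -- removing the top row.
  foldl-forbidStep-suc : ∀ a (α : Vec ℕ m) (is : List (Fin m)) (T : Tableau (suc m) n) →
    (λ i → foldl (forbidStep (a ∷ α)) T (map suc is) (suc i)) ≡ foldl (forbidStep α) (T ∘ suc) is
  foldl-forbidStep-suc a α []       T = refl
  foldl-forbidStep-suc a α (i ∷ is) T = trans
    (foldl-forbidStep-suc a α is (forbidStep (a ∷ α) T (suc i)))
    (cong (λ T → foldl (forbidStep α) T is) step)
    where
    step : forbidStep (a ∷ α) T (suc i) ∘ suc ≡ forbidStep α (T ∘ suc) i
    step = trans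
      (cong (λ cs k → forbid T (take (lookup α i) (blankCells T cs)) (suc k))
        (trans (cong (λ is → cartesianProduct is (columns n)) (rowsBelow-suc i)) (cartesianProduct-down (rowsBelow i))))
      (forbid-blanks-down (lookup α i) T (cellsBelow i))

  foldl-forbidStep-zero : ∀ a (α : Vec ℕ m) (is : List (Fin m)) (T : Tableau (suc m) n) →
    foldl (forbidStep (a ∷ α)) T (map suc is) zero ≡ T zero
  foldl-forbidStep-zero a α []       T = refl
  foldl-forbidStep-zero a α (i ∷ is) T = trans
    (foldl-forbidStep-zero a α is (forbidStep (a ∷ α) T (suc i)))
    (trans
      (cong (λ cs → forbid T (take (lookup α i) (blankCells T cs)) zero)
        (trans (cong (λ is → cartesianProduct is (columns n)) (rowsBelow-suc i)) (cartesianProduct-down (rowsBelow i))))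
      (forbid-blanks-down-zero (lookup α i) T (cellsBelow i)))

  forbidStep-top : ∀ a (α : Vec ℕ m) (T : Tableau (suc m) n) →
    forbidStep (a ∷ α) T zero ≡ forbid T (take a (blankCells T (map down allCells)))
  forbidStep-top a α T = cong (λ cs → forbid T (take a (blankCells T cs)))
    (trans (cong (λ is → cartesianProduct is (columns n)) (rowsBelow-zero {m})) (cartesianProduct-down (allFin m)))

  -- The top row acts on the others only through its arrivals, the first `a` blank cells below it.
  -- This is the summand `a` in the recursion of `departures`.
  forbidAll-suc : ∀ a (α : Vec ℕ m) (T : Tableau (suc m) n) →
    forbidAll (a ∷ α) T ∘ suc ≡ forbidAll α (forbid (T ∘ suc) (take a (blankCells (T ∘ suc) allCells)))
  forbidAll-suc a α T = begin
    forbidAll (a ∷ α) T ∘ suc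
      ≡⟨ cong (λ is i → foldl (forbidStep (a ∷ α)) T is (suc i)) (allFin-suc m) ⟩
    (λ i → foldl (forbidStep (a ∷ α)) (forbidStep (a ∷ α) T zero) (map suc (allFin m)) (suc i))
      ≡⟨ foldl-forbidStep-suc a α (allFin m) _ ⟩
    forbidAll α (forbidStep (a ∷ α) T zero ∘ suc)
      ≡⟨ cong (forbidAll α) (trans (cong (_∘ suc) (forbidStep-top a α T)) (forbid-blanks-down a T allCells)) ⟩
    forbidAll α (forbid (T ∘ suc) (take a (blankCells (T ∘ suc) allCells))) ∎
    where open ≡-Reasoning

  forbidAll-zero : ∀ a (α : Vec ℕ m) (T : Tableau (suc m) n) → forbidAll (a ∷ α) T zero ≡ T zero
  forbidAll-zero a α T = begin
    forbidAll (a ∷ α) T zero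
      ≡⟨ cong (λ is → foldl (forbidStep (a ∷ α)) T is zero) (allFin-suc m) ⟩
    foldl (forbidStep (a ∷ α)) (forbidStep (a ∷ α) T zero) (map suc (allFin m)) zero
      ≡⟨ foldl-forbidStep-zero a α (allFin m) _ ⟩
    forbidStep (a ∷ α) T zero zero
      ≡⟨ trans (cong-app (forbidStep-top a α T) zero) (forbid-blanks-down-zero a T allCells) ⟩
    T zero ∎
    where open ≡-Reasoning

-- The forbidding process as a queue

-- The fixed cells of α together with the first q of the other cells, in reading
-- order, as forbidden cells.
queueTableau : ∀ {m} n → ℕ → Vec ℕ m → Tableau m n
queueTableau n q (a ∷ α) zero    = shape a q
queueTableau n q (a ∷ α) (suc i) = queueTableau n (q ∸ (n ∸ a)) α i

-- If q and then p customers reach a row with b free cells, the overflow is the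
-- same as if they came together.
[q+p]∸b : ∀ q p b → q ∸ b + (p ∸ (b ∸ q)) ≡ q + p ∸ b
[q+p]∸b zero    p b       = cong (_+ (p ∸ b)) (0∸n≡0 b)
[q+p]∸b (suc q) p zero    = refl
[q+p]∸b (suc q) p (suc b) = [q+p]∸b q p b

-- The next `p` blank cells continue the initial segment of length `q` in the same reading order. In
-- the top row the block grows by `forbidRow-shape`; the two overflows add up by `[q+p]∸b`.
forbid-queueTableau : ∀ {m} n q p (α : Vec ℕ m) (T : Tableau m n) →
  (∀ i → T i ≗ queueTableau n q α i) →
  ∀ i → forbid T (take p (blankCells T allCells)) i ≗ queueTableau n (q + p) α i
forbid-queueTableau n q p (a ∷ α) T T≗ zero j =
  trans (cong-app (forbid-allCells-zero p T) j) (forbidRow-shape n a q p (T zero) (T≗ zero) j)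
forbid-queueTableau n q p (a ∷ α) T T≗ (suc i) j = begin
  forbid T (take p (blankCells T allCells)) (suc i) j
    ≡⟨ cong (λ T → T i j) (forbid-allCells-suc p T) ⟩
  forbid (T ∘ suc) (take (p ∸ length (blanks (T zero) (columns n))) (blankCells (T ∘ suc) allCells)) i j
    ≡⟨ forbid-queueTableau n (q ∸ (n ∸ a)) _ α (T ∘ suc) (T≗ ∘ suc) i j ⟩
  queueTableau n (q ∸ (n ∸ a) + (p ∸ length (blanks (T zero) (columns n)))) α i j
    ≡⟨ cong (λ k → queueTableau n (q ∸ (n ∸ a) + (p ∸ k)) α i j) (length-blanks-shape n a q (T zero) (T≗ zero)) ⟩
  queueTableau n (q ∸ (n ∸ a) + (p ∸ (n ∸ a ∸ q))) α i j
    ≡⟨ cong (λ k → queueTableau n k α i j) ([q+p]∸b q p (n ∸ a)) ⟩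
  queueTableau n (q + p ∸ (n ∸ a)) α i j ∎
  where open ≡-Reasoning

-- The forbidden cells of the top row are final, since every step acts below it; `shape-⊓` reads
-- them as departures. The overflow `q ∸ (n ∸ a)` and the `a` newly forbidden cells form the queue
-- of the next row.
forbidAll-queueTableau : ∀ {m} n q (α : Vec ℕ m) (T : Tableau m n) →
  (∀ i → T i ≗ queueTableau n q α i) →
  ∀ i → forbidAll α T i ≗ shape (lookup α i) (lookup (departures n q α) i)
forbidAll-queueTableau n q (a ∷ α) T T≗ zero j =
  trans (cong-app (forbidAll-zero a α T) j) (trans (T≗ zero j) (sym (shape-⊓ a q j)))
forbidAll-queueTableau n q (a ∷ α) T T≗ (suc i) j =
  trans (cong (λ T → T i j) (forbidAll-suc a α T))
        (forbidAll-queueTableau n (q ∸ (n ∸ a) + a) α _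
          (forbid-queueTableau n (q ∸ (n ∸ a)) a α (T ∘ suc) (T≗ ∘ suc)) i j)

fixCells-queueTableau : ∀ {m} n (α : Vec ℕ m) i → fixCells {n = n} α i ≗ queueTableau n 0 α i
fixCells-queueTableau n (a ∷ α) zero    j with <-≤-connex (toℕ j) a
... | inj₁ j<a rewrite dec-true (toℕ j <? a) j<a = refl
... | inj₂ a≤j rewrite dec-false (toℕ j <? a) (≤⇒≯ a≤j)
                     | dec-false (n ∸ toℕ j ≤? 0) (<⇒≱ (m<n⇒0<n∸m (toℕ<n j))) = refl
fixCells-queueTableau n (a ∷ α) (suc i) j rewrite 0∸n≡0 (n ∸ a) = fixCells-queueTableau n α i j

foldl-filter : ∀ {A B : Set} {P : Pred B 0ℓ} (P? : Decidable P) (f : A → B → A) →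
  (∀ z x → ¬ P x → f z x ≡ z) → ∀ z xs → foldl f z (filter P? xs) ≡ foldl f z xs
foldl-filter P? f skip z []       = refl
foldl-filter P? f skip z (x ∷ xs) with P? x
... | yes _  = foldl-filter P? f skip (f z x) xs
... | no ¬px = trans (foldl-filter P? f skip z xs) (cong (λ z → foldl f z xs) (sym (skip z x ¬px)))

forbidCells≡forbidAll : ∀ {m n} (α : Vec ℕ m) (T : Tableau m n) → forbidCells α T ≡ forbidAll α T
forbidCells≡forbidAll {m} {n} α T =
  foldl-filter (λ i → suc (toℕ i) <? m) (forbidStep α) lastStep T (allFin m)
  where
  lastStep : ∀ (T : Tableau m n) i → ¬ (suc (toℕ i) < m) → forbidStep α T i ≡ T
  lastStep T i ¬i<m = trans
    (cong (λ is → forbid T (take (lookup α i) (blankCells T (cartesianProduct is (columns n)))))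
      (filter-none (i Fin.<?_) (All.universal (λ k i<k → ¬i<m (≤-<-trans i<k (toℕ<n k))) (allFin m))))
    (cong (forbid T) (take-[] (lookup α i)))

forbidCells-shape : ∀ {m} n (α : Vec ℕ m) i →
  forbidCells α (fixCells {n = n} α) i ≗ shape (lookup α i) (lookup (departures n 0 α) i)
forbidCells-shape n α i j =
  trans (cong (λ T → T i j) (forbidCells≡forbidAll α (fixCells α)))
        (forbidAll-queueTableau n 0 α (fixCells α) (fixCells-queueTableau n α) i j)

-- Numbering the blank cells

at : ∀ {m n} → Tableau m n → Cell m n → Entry
at T (i , j) = T i j

module _ {m n : ℕ} (T : Tableau m n) (x : Entry) where

  ≔-updates : ∀ c → at (T [ c ]≔ x) c ≡ x
  ≔-updates (i , j) = trans (cong-app (updateAt-updates i T) j) (updateAt-updates j (T i))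

  ≔-minimal : ∀ c d → d ≢ c → at (T [ c ]≔ x) d ≡ at T d
  ≔-minimal (i , j) (i′ , j′) d≢c with i′ Fin.≟ i
  ... | no i′≢i = cong-app (updateAt-minimal i′ i T i′≢i) j′
  ... | yes refl = trans (cong-app (updateAt-updates i T) j′)
                         (updateAt-minimal j′ j (T i) λ { refl → d≢c refl })

fillFrom-∉ : ∀ {m n} r cs (T : Tableau m n) {c} → c ∉ cs → at (fillFrom r cs T) c ≡ at T c
fillFrom-∉ r []       T     c∉cs = refl
fillFrom-∉ r (d ∷ cs) T {c} c∉cs =
  trans (fillFrom-∉ (suc r) cs (T [ d ]≔ number r) (c∉cs ∘ there))
        (≔-minimal T (number r) d c (c∉cs ∘ here))

-- The entry is the position in the list, provided that no later write overwrites it; `c ∉ ys`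
-- ensures this.
fillFrom-++ : ∀ {m n} r xs {c} ys (T : Tableau m n) → c ∉ ys →
  at (fillFrom r (xs ++ c ∷ ys) T) c ≡ number (r + length xs)
fillFrom-++ r []       {c} ys T c∉ys rewrite +-identityʳ r =
  trans (fillFrom-∉ (suc r) ys (T [ c ]≔ number r) c∉ys) (≔-updates T (number r) c)
fillFrom-++ r (x ∷ xs) ys T c∉ys rewrite +-suc r (length xs) = fillFrom-++ (suc r) xs ys (T [ x ]≔ number r) c∉ys

blankCell? : ∀ {m n} (T : Tableau m n) → Decidable λ c → at T c ≡ blank
blankCell? T (i , j) = blank? (T i j)

fill-nonblank : ∀ {m n} (T : Tableau m n) c → at T c ≢ blank → at (fill T) c ≡ at T c
fill-nonblank T c c≢blank = fillFrom-∉ 1 _ T (c≢blank ∘ proj₂ ∘ ∈-filter⁻ (blankCell? T) {xs = fillingOrder})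

-- Splitting the filling order at `c` makes the entry a count of the blank cells before `c`, a form
-- suited to reversing the order.
fill-blank : ∀ {m n} (T : Tableau m n) {xs c ys} → fillingOrder ≡ xs ++ c ∷ ys → c ∉ ys → at T c ≡ blank →
  at (fill T) c ≡ number (suc (length (blankCells T xs)))
fill-blank T {xs} {c} {ys} eq c∉ys c≡blank = begin
  at (fillFrom 1 (blankCells T fillingOrder) T) c
    ≡⟨ cong (λ cs → at (fillFrom 1 cs T) c) blanks≡ ⟩
  at (fillFrom 1 (blankCells T xs ++ c ∷ blankCells T ys) T) c
    ≡⟨ fillFrom-++ 1 (blankCells T xs) _ T (c∉ys ∘ proj₁ ∘ ∈-filter⁻ (blankCell? T)) ⟩
  number (suc (length (blankCells T xs))) ∎
  where
  open ≡-Reasoning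
  blanks≡ : blankCells T fillingOrder ≡ blankCells T xs ++ c ∷ blankCells T ys
  blanks≡ = trans (cong (blankCells T) eq)
    (trans (filter-++ (blankCell? T) xs (c ∷ ys))
           (cong (blankCells T xs ++_) (filter-accept (blankCell? T) c≡blank)))

-- Rotation of cells and the filling order

turn : ∀ {m n} → Cell m n → Cell m n
turn (i , j) = opposite i , opposite j

turn-involutive : ∀ {m n} (c : Cell m n) → turn (turn c) ≡ c
turn-involutive (i , j) = cong₂ _,_ (opposite-involutive i) (opposite-involutive j)

tabulate-∷ʳ : ∀ {A : Set} n (f : Fin (suc n) → A) →
  List.tabulate f ≡ List.tabulate (f ∘ Fin.inject₁) ++ f (Fin.fromℕ n) ∷ []
tabulate-∷ʳ zero    f = refl
tabulate-∷ʳ (suc n) f = cong (f zero ∷_) (tabulate-∷ʳ n (f ∘ suc))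

reverse-allFin : ∀ n → reverse (allFin n) ≡ map opposite (allFin n)
reverse-allFin zero    = refl
reverse-allFin (suc n) = begin
  reverse (allFin (suc n))
    ≡⟨ cong reverse (tabulate-∷ʳ n id) ⟩
  reverse (List.tabulate Fin.inject₁ ++ Fin.fromℕ n ∷ [])
    ≡⟨ reverse-++ (List.tabulate Fin.inject₁) _ ⟩
  Fin.fromℕ n ∷ reverse (List.tabulate Fin.inject₁)
    ≡⟨ cong (λ is → Fin.fromℕ n ∷ reverse is) (map-tabulate id Fin.inject₁) ⟨
  Fin.fromℕ n ∷ reverse (map Fin.inject₁ (allFin n))
    ≡⟨ cong (Fin.fromℕ n ∷_) (reverse-map Fin.inject₁ (allFin n)) ⟨
  Fin.fromℕ n ∷ map Fin.inject₁ (reverse (allFin n))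
    ≡⟨ cong (λ is → Fin.fromℕ n ∷ map Fin.inject₁ is) (reverse-allFin n) ⟩
  Fin.fromℕ n ∷ map Fin.inject₁ (map opposite (allFin n))
    -- `Fin.inject₁ (opposite i)` and `opposite (suc i)` agree by definition, so both compositions
    -- are the same map.
    ≡⟨ cong (Fin.fromℕ n ∷_) (trans (sym (map-∘ (allFin n))) (map-∘ (allFin n))) ⟩
  Fin.fromℕ n ∷ map opposite (map suc (allFin n))
    ≡⟨ cong (map opposite) (allFin-suc n) ⟨
  map opposite (allFin (suc n)) ∎
  where open ≡-Reasoning

reverse-cartesianProduct : ∀ {A B : Set} (xs : List A) (ys : List B) →
  reverse (cartesianProduct xs ys) ≡ cartesianProduct (reverse xs) (reverse ys)
reverse-cartesianProduct []       ys = refl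
reverse-cartesianProduct (x ∷ xs) ys = begin
  reverse (map (x ,_) ys ++ cartesianProduct xs ys)
    ≡⟨ reverse-++ (map (x ,_) ys) _ ⟩
  reverse (cartesianProduct xs ys) ++ reverse (map (x ,_) ys)
    ≡⟨ cong₂ _++_ (reverse-cartesianProduct xs ys) (trans (sym (reverse-map (x ,_) ys)) (sym (++-identityʳ _))) ⟩
  cartesianProduct (reverse xs) (reverse ys) ++ cartesianProduct (x ∷ []) (reverse ys)
    ≡⟨ cartesianProductWith-distribʳ-++ _,_ (reverse xs) (x ∷ []) (reverse ys) ⟨
  cartesianProduct (reverse xs ++ x ∷ []) (reverse ys)
    ≡⟨ cong (λ zs → cartesianProduct zs (reverse ys)) (unfold-reverse x xs) ⟨
  cartesianProduct (reverse (x ∷ xs)) (reverse ys) ∎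
  where open ≡-Reasoning

module _ {m n : ℕ} where

  turn-fillingOrder : map turn (reverse (fillingOrder {m} {n})) ≡ fillingOrder
  turn-fillingOrder = begin
    map turn (reverse fillingOrder)
      ≡⟨ cong (map turn) (reverse-cartesianProduct (reverse (allFin m)) (allFin n)) ⟩
    map turn (cartesianProduct (reverse (reverse (allFin m))) (reverse (allFin n)))
      ≡⟨ cong (λ is → map turn (cartesianProduct is (reverse (allFin n)))) (reverse-involutive (allFin m)) ⟩
    map turn (cartesianProduct (allFin m) (reverse (allFin n)))
      ≡⟨ cartesianProduct-map opposite opposite (allFin m) (reverse (allFin n)) ⟨
    cartesianProduct (map opposite (allFin m)) (map opposite (reverse (allFin n)))
      ≡⟨ cong₂ cartesianProduct (sym (reverse-allFin m)) opposite-reverse ⟩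
    fillingOrder ∎
    where
    open ≡-Reasoning
    opposite-reverse : map opposite (reverse (allFin n)) ≡ allFin n
    opposite-reverse = trans (reverse-map opposite (allFin n))
      (trans (cong reverse (sym (reverse-allFin n))) (reverse-involutive (allFin n)))

  fillingOrder-unique : Unique (fillingOrder {m} {n})
  fillingOrder-unique rewrite reverse-allFin m =
    Unique.cartesianProduct⁺ (Unique.map⁺ opposite-injective (Unique.allFin⁺ m)) (Unique.allFin⁺ n)
    where
    opposite-injective : {i k : Fin m} → opposite i ≡ opposite k → i ≡ k
    opposite-injective {i} {k} eq =
      trans (sym (opposite-involutive i)) (trans (cong opposite eq) (opposite-involutive k))

  ∈-fillingOrder : (c : Cell m n) → c ∈ fillingOrder
  ∈-fillingOrder (i , j) rewrite reverse-allFin m = ∈-cartesianProduct⁺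
    (subst (_∈ map opposite (allFin m)) (opposite-involutive i) (∈-map⁺ opposite (∈-allFin (opposite i))))
    (∈-allFin j)

Unique-++⇒∉ : ∀ {A : Set} xs {x : A} {ys} → Unique (xs ++ x ∷ ys) → x ∉ ys
Unique-++⇒∉ []       (x∉ys ∷ _) x∈ys = All.lookup x∉ys x∈ys refl
Unique-++⇒∉ (_ ∷ xs) (_ ∷ u)         = Unique-++⇒∉ xs u

reverse-++-∷ : ∀ {A : Set} (xs : List A) x ys → reverse (xs ++ x ∷ ys) ≡ reverse ys ++ x ∷ reverse xs
reverse-++-∷ xs x ys = begin
  reverse (xs ++ x ∷ ys)                 ≡⟨ reverse-++ xs (x ∷ ys) ⟩
  reverse (x ∷ ys) ++ reverse xs         ≡⟨ cong (_++ reverse xs) (unfold-reverse x ys) ⟩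
  (reverse ys ++ x ∷ []) ++ reverse xs   ≡⟨ ++-assoc (reverse ys) _ _ ⟩
  reverse ys ++ x ∷ reverse xs           ∎
  where open ≡-Reasoning

fill-blank⇒number : ∀ {m n} (T : Tableau m n) c → at T c ≡ blank → IsNumber (at (fill T) c)
fill-blank⇒number T c c≡blank with xs , ys , eq ← ∈-∃++ (∈-fillingOrder c) =
  _ , fill-blank T eq (Unique-++⇒∉ xs (subst Unique eq fillingOrder-unique)) c≡blank

-- Rotation reverses the numbering

module _ {m n : ℕ} (T T′ : Tableau m n)
  (unnumbered : ∀ c → ¬ IsNumber (at T c))
  -- The `0` stands in for the number of fillable cells: before filling, no cell of `T` carries a
  -- number to be reversed.
  (rotated    : ∀ c → at T′ (turn c) ≡ rotateEntry 0 (at T c)) where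

  numberCount-fill : numberCount (fill T) ≡ length (blankCells T fillingOrder)
  numberCount-fill = cong length (filter-≐ (λ (i , j) → number? (fill T i j)) (blankCell? T)
    ((λ {c} → number⇒blank c) , (λ {c} → fill-blank⇒number T c)) fillingOrder)
    where
    number⇒blank : ∀ c → IsNumber (at (fill T) c) → at T c ≡ blank
    number⇒blank c isNumber with blank? (at T c)
    ... | yes c≡blank = c≡blank
    ... | no  c≢blank = contradiction (subst IsNumber (fill-nonblank T c c≢blank) isNumber) (unnumbered c)

  length-blanks-turned : ∀ cs → length (blankCells T′ (map turn (reverse cs))) ≡ length (blankCells T cs)
  length-blanks-turned cs = begin
    length (blankCells T′ (map turn (reverse cs)))
      ≡⟨ cong length (filter-map (blankCell? T′) turn (reverse cs)) ⟩
    length (map (turn {m} {n}) (filter (blankCell? T′ ∘ turn) (reverse cs)))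
      ≡⟨ length-map turn (filter (blankCell? T′ ∘ turn) (reverse cs)) ⟩
    length (filter (blankCell? T′ ∘ turn) (reverse cs))
      ≡⟨ cong length (filter-≐ (blankCell? T′ ∘ turn) (blankCell? T)
           ((λ {c} → from c) , λ {c} c≡blank → trans (rotated c) (cong (rotateEntry 0) c≡blank)) (reverse cs)) ⟩
    length (blankCells T (reverse cs))
      ≡⟨ ↭-length (filter-↭ (blankCell? T) (↭-reverse cs)) ⟩
    length (blankCells T cs) ∎
    where
    open ≡-Reasoning
    from : ∀ c → at T′ (turn c) ≡ blank → at T c ≡ blank
    from c eq with at T c | rotated c
    ... | blank     | _ = refl
    ... | fixed     | r = contradiction (trans (sym r) eq) λ ()
    ... | forbidden | r = contradiction (trans (sym r) eq) λ ()
    ... | number _  | r = contradiction (trans (sym r) eq) λ ()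

  -- A blank cell with x blank cells before it and y after it gets the number x + 1. After rotation
  -- y of them come before it, and y + 1 is (ℓ + 1) - (x + 1) because ℓ = x + 1 + y.
  fill-turn : ∀ c → at (fill T′) (turn c) ≡ rotateEntry (numberCount (fill T)) (at (fill T) c)
  fill-turn c with at T c in Tc
  ... | fixed     =
    trans (trans (fill-nonblank T′ (turn c) λ eq → contradiction (trans (sym T′c) eq) λ ()) T′c)
          (cong (rotateEntry _) (sym (trans (fill-nonblank T c λ eq → contradiction (trans (sym Tc) eq) λ ()) Tc)))
    where T′c = trans (rotated c) (cong (rotateEntry 0) Tc)
  ... | forbidden =
    trans (trans (fill-nonblank T′ (turn c) λ eq → contradiction (trans (sym T′c) eq) λ ()) T′c)
          (cong (rotateEntry _) (sym (trans (fill-nonblank T c λ eq → contradiction (trans (sym Tc) eq) λ ()) Tc)))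
    where T′c = trans (rotated c) (cong (rotateEntry 0) Tc)
  ... | number r  = contradiction (r , Tc) (unnumbered c)
  ... | blank with xs , ys , eq ← ∈-∃++ (∈-fillingOrder c) = begin
    at (fill T′) (turn c)
      ≡⟨ fill-blank T′ eq′ (Unique-++⇒∉ _ (subst Unique eq′ fillingOrder-unique))
           (trans (rotated c) (cong (rotateEntry 0) Tc)) ⟩
    number (suc (length (blankCells T′ (map turn (reverse ys)))))
      ≡⟨ cong (number ∘ suc) (length-blanks-turned ys) ⟩
    number (suc (length (blankCells T ys)))
      ≡⟨ cong number (m+n∸m≡n (length (blankCells T xs)) _) ⟨
    number (length (blankCells T xs) + suc (length (blankCells T ys)) ∸ length (blankCells T xs))
      -- The successor in `rotateEntry` cancels by computation against the one in the entry of `c`.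
      ≡⟨ cong (λ ℓ → number (ℓ ∸ length (blankCells T xs))) count ⟨
    rotateEntry (numberCount (fill T)) (number (suc (length (blankCells T xs))))
      ≡⟨ cong (rotateEntry _) (fill-blank T eq (Unique-++⇒∉ xs (subst Unique eq fillingOrder-unique)) Tc) ⟨
    rotateEntry (numberCount (fill T)) (at (fill T) c) ∎
    where
    open ≡-Reasoning
    eq′ : fillingOrder ≡ map turn (reverse ys) ++ turn c ∷ map turn (reverse xs)
    eq′ = trans (sym turn-fillingOrder)
      (trans (cong (map turn) (trans (cong reverse eq) (reverse-++-∷ xs c ys)))
             (map-++ turn (reverse ys) (c ∷ reverse xs)))
    count : numberCount (fill T) ≡ length (blankCells T xs) + suc (length (blankCells T ys))
    count = begin
      numberCount (fill T)                             ≡⟨ numberCount-fill ⟩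
      length (blankCells T fillingOrder)               ≡⟨ cong (length ∘ blankCells T) eq ⟩
      length (blankCells T (xs ++ c ∷ ys))             ≡⟨ cong length (filter-++ (blankCell? T) xs (c ∷ ys)) ⟩
      length (blankCells T xs ++ blankCells T (c ∷ ys)) ≡⟨ length-++ (blankCells T xs) ⟩
      length (blankCells T xs) + length (blankCells T (c ∷ ys))
        ≡⟨ cong (λ cs → length (blankCells T xs) + length cs) (filter-accept (blankCell? T) Tc) ⟩
      length (blankCells T xs) + suc (length (blankCells T ys)) ∎

-- `ψ` as the reversed departures

shape-unnumbered : ∀ {n} a q (j : Fin n) → ¬ IsNumber (shape a q j)
shape-unnumbered {n} a q j (r , eq) with <-≤-connex (toℕ j) a
... | inj₁ j<a = contradiction (trans (sym (shape-fixed j j<a)) eq) λ ()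
... | inj₂ a≤j with ≤-<-connex (n ∸ toℕ j) q
...   | inj₁ le = contradiction (trans (sym (shape-forbidden j a≤j le)) eq) λ ()
...   | inj₂ gt = contradiction (trans (sym (shape-blank j a≤j gt)) eq) λ ()

departures≤ : ∀ {m} n q (α : Vec ℕ m) i → lookup (departures n q α) i ≤ n ∸ lookup α i
departures≤ n q (a ∷ α) zero    = m⊓n≤m (n ∸ a) q
departures≤ n q (a ∷ α) (suc i) = departures≤ n _ α i

fill-forbidden⁻ : ∀ {m n} (T : Tableau m n) c → at (fill T) c ≡ forbidden → at T c ≡ forbidden
fill-forbidden⁻ T c eq with blank? (at T c)
... | no  c≢blank = trans (sym (fill-nonblank T c c≢blank)) eq
... | yes c≡blank = contradiction (trans (sym (proj₂ (fill-blank⇒number T c c≡blank))) eq) λ ()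

fill-forbidden⁺ : ∀ {m n} (T : Tableau m n) c → at T c ≡ forbidden → at (fill T) c ≡ forbidden
fill-forbidden⁺ T c eq = trans (fill-nonblank T c λ c≡blank → contradiction (trans (sym eq) c≡blank) λ ()) eq

αᴱ-departures : ∀ {m} n (α : Vec ℕ m) i → αᴱ n α i ≡ lookup (departures n 0 α) i
αᴱ-departures n α i = begin
  αᴱ n α i
    -- Filling changes blank cells only and turns them into numbers, so the forbidden cells can be
    -- counted before it.
    ≡⟨ cong length (filter-≐ (λ j → forbidden? (C n α i j)) (λ j → forbidden? (shape a e j))
        ( (λ {j} eq → trans (sym (forbidCells-shape n α i j)) (fill-forbidden⁻ T (i , j) eq))
        , (λ {j} eq → fill-forbidden⁺ T (i , j) (trans (forbidCells-shape n α i j) eq))) (allFin n)) ⟩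
  length (filter (λ j → forbidden? (shape a e j)) (allFin n)) ≡⟨ length-forbidden-shape n a e ⟩
  (n ∸ a) ⊓ e   ≡⟨ m≥n⇒m⊓n≡n (departures≤ n 0 α i) ⟩
  e             ∎
  where
  open ≡-Reasoning
  a = lookup α i
  e = lookup (departures n 0 α) i
  T = forbidCells α (fixCells {n = n} α)

tabulate-opposite : ∀ {A : Set} {m} (α : Vec A m) → Vec.tabulate (lookup α ∘ opposite) ≡ Vec.reverse α
tabulate-opposite α = trans
  (tabulate-cong λ i → trans (sym (lookup-reverse-opposite α (opposite i)))
                             (cong (lookup (Vec.reverse α)) (opposite-involutive i)))
  (tabulate∘lookup (Vec.reverse α))

-- The `0` appended by `ψ` is the number of departures from the top row, where the queue is still
-- empty.
ψ-departures : ∀ {m} n (α : Vec ℕ m) → ψ n α ≡ Vec.reverse (departures n 0 α)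
ψ-departures n []      = refl
ψ-departures n (a ∷ α) = begin
  Vec.tabulate (λ i → αᴱ n (a ∷ α) (suc (opposite i))) ∷ʳ 0
    ≡⟨ cong (_∷ʳ 0) (tabulate-cong λ i → αᴱ-departures n (a ∷ α) (suc (opposite i))) ⟩
  Vec.tabulate (lookup e ∘ opposite) ∷ʳ 0
    ≡⟨ cong₂ _∷ʳ_ (tabulate-opposite e) (sym (⊓-zeroʳ (n ∸ a))) ⟩
  Vec.reverse e ∷ʳ ((n ∸ a) ⊓ 0)
    ≡⟨ reverse-∷ ((n ∸ a) ⊓ 0) e ⟨
  Vec.reverse (((n ∸ a) ⊓ 0) ∷ e) ∎
  where
  open ≡-Reasoning
  e = departures n (0 ∸ (n ∸ a) + a) α

-- The involution and the rotated tableau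

theorem13 : (m n : ℕ) → .{{_ : NonZero m}} → .{{_ : NonZero n}} →
    (α : Vec ℕ m) → S m n α →
    S m n (ψ n α)
    × ψ n (ψ n α) ≡ α
    × (∀ i j → C n (ψ n α) i j ≡ rotate (C n α) i j)
-- Replacing `ψ n α` by the reversed departures `β` turns all three claims into statements about the
-- queue run from `β`.
theorem13 m n α s = subst Claim (sym (ψ-departures n α)) (β∈S , ψβ≡α , rotated)
  where
  Claim : Vec ℕ m → Set
  Claim β = S m n β × ψ n β ≡ α × (∀ i j → C n β i j ≡ rotate (C n α) i j)

  e β : Vec ℕ m
  e = departures n 0 α
  β = Vec.reverse e

  end≡0 : finalQueue n 0 α ≡ 0
  end≡0 = S⇒finalQueue≡0 n α s

  -- The backward run starts from the final queue of `α`, which is empty, so it is the run that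
  -- `C n β` uses.
  β-departures : departures n 0 β ≡ Vec.reverse α
  β-departures = subst (λ q → departures n q β ≡ Vec.reverse α) end≡0 (proj₁ (reversal n 0 α (S.bounded s)))

  β-end : finalQueue n 0 β ≡ 0
  β-end = subst (λ q → finalQueue n q β ≡ 0) end≡0 (proj₂ (reversal n 0 α (S.bounded s)))

  lookup-β : ∀ i → lookup β (opposite i) ≡ lookup e i
  lookup-β = lookup-reverse-opposite e

  β-bounded : Bounded n β
  β-bounded i = subst (_≤ n) (trans (sym (lookup-β (opposite i))) (cong (lookup β) (opposite-involutive i)))
    (≤-trans (departures≤ n 0 α (opposite i)) (m∸n≤m n (lookup α (opposite i))))

  sum-β : Vec.sum β ≡ Vec.sum α
  sum-β = begin
    Vec.sum β                        ≡⟨ sum-reverse e ⟩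
    Vec.sum e                        ≡⟨ +-identityʳ _ ⟨
    Vec.sum e + 0                    ≡⟨ cong (Vec.sum e +_) end≡0 ⟨
    Vec.sum e + finalQueue n 0 α     ≡⟨ conservation n 0 α ⟩
    Vec.sum α                        ∎
    where open ≡-Reasoning

  β∈S : S m n β
  β∈S = finalQueue≡0⇒S n β β-bounded (subst (_≤ ⌊ m * n /2⌋) (sym sum-β) (S.size s)) β-end

  ψβ≡α : ψ n β ≡ α
  ψβ≡α = trans (ψ-departures n β) (trans (cong Vec.reverse β-departures) (Vec-reverse-involutive α))

  T T′ : Tableau m n
  T  = forbidCells α (fixCells α)
  T′ = forbidCells β (fixCells β)

  T′-rotated : ∀ c → at T′ (turn c) ≡ rotateEntry 0 (at T c)
  T′-rotated (i , j) = begin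
    T′ (opposite i) (opposite j)
      ≡⟨ forbidCells-shape n β (opposite i) (opposite j) ⟩
    shape (lookup β (opposite i)) (lookup (departures n 0 β) (opposite i)) (opposite j)
      ≡⟨ cong₂ (λ a q → shape a q (opposite j)) (lookup-β i)
          (trans (cong (λ δ → lookup δ (opposite i)) β-departures) (lookup-reverse-opposite α i)) ⟩
    shape (lookup e i) (lookup α i) (opposite j)
      ≡⟨ shape-rotated 0 (lookup α i) (lookup e i) (departures≤ n 0 α i) j ⟩
    rotateEntry 0 (shape (lookup α i) (lookup e i) j)
      ≡⟨ cong (rotateEntry 0) (forbidCells-shape n α i j) ⟨
    rotateEntry 0 (T i j) ∎
    where open ≡-Reasoning

  rotated : ∀ i j → C n β i j ≡ rotate (C n α) i j
  -- `rotate` reads the old tableau at the turned cell, so `fill-turn` is applied to `turn (i , j)`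
  -- and the double turn is undone.
  rotated i j = subst (λ c → at (C n β) c ≡ rotate (C n α) i j) (turn-involutive (i , j))
    (fill-turn T T′
      (λ (i , j) isNumber → shape-unnumbered (lookup α i) (lookup e i) j
        (subst IsNumber (forbidCells-shape n α i j) isNumber))
      T′-rotated (turn (i , j)))
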